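{- Let $p$ be an even integer and let $n$ be an odd integer with $n\ge p+1\ge 5$. Then there exists a simple graph of order $n$ and size $\mathrm{ex}(n,K_{1,p})+1$ which contains exactly one copy of $K_{1,p}$.
   Context: All graphs are finite and simple. The order of a graph is its number of vertices and its size is its number of edges. A copy of $H$ in $G$ is a subgraph of $G$ isomorphic to $H$; the number of copies of $H$ in $G$ is the number of distinct subgraphs of $G$ isomorphic to $H$. For a graph $H$ and a positive integer $n$, the Turán number $\mathrm{ex}(n,H)$ is the maximum size of a simple graph of order $n$ containing no copy of $H$. $K_{1,p}$ denotes the star with $p$ edges (order $p+1$). -}

module Defs where

open import Data.Bool.Base using (Bool; true; false; T)
open import Data.Bool.Properties using (T?)
open import Data.Fin.Base using (Fin; zero; suc)
open import Data.Fin.Properties using (_<?_)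
open import Data.Fin.Subset using (Subset; _∈_)
open import Data.List.Base using (List; allFin; cartesianProduct; filter; length)
open import Data.Nat.Base using (ℕ; suc; _≤_)
open import Data.Product.Base using (Σ-syntax; ∃-syntax; _×_; _,_; proj₁)
open import Data.Unit.Base using (tt)
open import Function.Base using (_∘_)
open import Function.Bundles using (_↔_; Inverse)
open import Relation.Binary.PropositionalEquality.Core using (_≡_)
open import Relation.Nullary.Decidable using (_×-dec_)
open import Relation.Nullary.Negation using (¬_)

-- Simple graphs on the vertex type V; those of order n are the Graph (Fin n).
record Graph (V : Set) : Set where
  field
    adj         : V → V → Bool
    symmetric   : ∀ {u v} → T (adj u v) → T (adj v u)
    irreflexive : ∀ {v} → ¬ T (adj v v)

open Graph public using (adj)

-- Each edge {i , j} is listed once, as the pair with i < j.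
edges : ∀ {n} → Graph (Fin n) → List (Fin n × Fin n)
edges {n} G =
  filter (λ (i , j) → (i <? j) ×-dec T? (adj G i j))
         (cartesianProduct (allFin n) (allFin n))

size : ∀ {n} → Graph (Fin n) → ℕ
size G = length (edges G)

infix 4 _≅_

_≅_ : ∀ {V W : Set} → Graph V → Graph W → Set
_≅_ {V} {W} G H =
  Σ[ f ∈ V ↔ W ] (∀ u v → adj G u v ≡ adj H (Inverse.to f u) (Inverse.to f v))

-- Not necessarily induced or spanning.
record Subgraph {n : ℕ} (G : Graph (Fin n)) : Set where
  field
    vertices  : Subset n
    edge      : Fin n → Fin n → Bool
    symmetric : ∀ {u v} → T (edge u v) → T (edge v u)
    incident  : ∀ {u v} → T (edge u v) → u ∈ vertices
    included  : ∀ {u v} → T (edge u v) → T (adj G u v)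

  graph : Graph (∃[ v ] v ∈ vertices)
  graph = record
    { adj         = λ u v → edge (proj₁ u) (proj₁ v)
    ; symmetric   = symmetric
    ; irreflexive = Graph.irreflexive G ∘ included
    }

infix 4 _≈_

-- Equality of subgraphs: same vertex set and same edge set.
_≈_ : ∀ {n} {G : Graph (Fin n)} → Subgraph G → Subgraph G → Set
S ≈ S′ = Subgraph.vertices S ≡ Subgraph.vertices S′
       × (∀ u v → Subgraph.edge S u v ≡ Subgraph.edge S′ u v)

IsCopy : ∀ {W : Set} {n} → Graph W → {G : Graph (Fin n)} → Subgraph G → Set
IsCopy H S = Subgraph.graph S ≅ H

infix 4 _Free_

_Free_ : ∀ {W : Set} {n} → Graph W → Graph (Fin n) → Set
H Free G = ¬ (∃[ S ] IsCopy H {G} S)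

-- m = ex(n,H), given as a relation: m is the maximum size of an H-free graph
-- of order n, so it is attained and is an upper bound.
IsTuránNumber : ∀ {W : Set} → ℕ → Graph W → ℕ → Set
IsTuránNumber n H m =
    (∃[ G ] H Free G × size {n} G ≡ m)
  × (∀ (G : Graph (Fin n)) → H Free G → size G ≤ m)

-- K₁,ₚ with centre zero.
star : ∀ p → Graph (Fin (suc p))
star p = record
  { adj         = starAdj
  ; symmetric   = λ {u} {v} → starSym u v
  ; irreflexive = λ {v} → starIrr v
  }
  where
  starAdj : Fin (suc p) → Fin (suc p) → Bool
  starAdj zero    zero    = false
  starAdj zero    (suc _) = true
  starAdj (suc _) zero    = true
  starAdj (suc _) (suc _) = false

  starSym : ∀ u v → T (starAdj u v) → T (starAdj v u)
  starSym zero    (suc _) _ = tt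
  starSym (suc _) zero    _ = tt

  starIrr : ∀ v → ¬ T (starAdj v v)
  starIrr zero    ()
  starIrr (suc _) ()

{-# OPTIONS --safe #-}
module Submission where

-- Write p = 2k + 2 and n = 2m + 1 with k < m. A graph is K₁,ₚ-free iff all its
-- degrees are at most p - 1, so by the handshake lemma it has at most
-- (n (p - 1) - 1) / 2 edges, n (p - 1) being odd. On ℤ/n take all chords of
-- length 1, …, k, which gives a 2k-regular graph. The edges {i , i + m} with
-- i < m are new (as k < m) and form a matching missing only the vertex 2m:
-- adding them attains the bound. Adding also {m , 2m} makes m the only vertex
-- of degree p, all others having degree p - 1, so the star at m is the only copy.

open import Defs
open import Data.Bool.Base using (Bool; true; false; T; _∧_; _∨_)
open import Data.Bool.Properties using (T?; T-≡; T-∧; T-∨; ∨-comm)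
open import Data.Empty using (⊥-elim)
open import Data.Fin.Base using (Fin; zero; suc; toℕ; fromℕ<; inject≤; opposite)
open import Data.Fin.Permutation using (reverse)
open import Data.Fin.Properties
  using (_≟_; _<?_; <-cmp; any?; toℕ<n; toℕ-fromℕ<; toℕ-injective; suc-injective;
         opposite-prop; injective⇒≤; inject≤-injective)
open import Data.Fin.Subset using (Subset; _∈_; _⊆_)
open import Data.Fin.Subset.Properties using (⊆-antisym)
open import Data.List.Base as List using (length; filter; _++_; tabulate; cartesianProduct)
open import Data.List.Properties using (filter-++; length-++; map-tabulate)
open import Data.Nat.Base
  using (ℕ; zero; suc; _+_; _*_; _∸_; ∣_-_∣; _≤_; _<_; _≥_; _<ᵇ_; _≡ᵇ_; z≤n; s≤s)
open import Data.Nat.Divisibility using (_∣_; _∤_; divides; m%n≡0⇒n∣m)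
open import Data.Nat.DivMod using (_%_; _/_; m≡m%n+[m/n]*n; m%n<n)
open import Data.Nat.Properties as ℕ
  using (+-*-semiring; +-comm; +-assoc; +-identityʳ; +-suc; *-comm; ≤-trans; ≤-refl; ≤-reflexive;
         +-mono-≤; m≤m+n; <ᵇ⇒<; <⇒<ᵇ; ≡ᵇ⇒≡; ≡⇒≡ᵇ)
open import Data.Nat.Tactic.RingSolver using (solve-∀)
open import Data.Product using (Σ-syntax; ∃-syntax; ∃!; _×_; _,_; proj₁; proj₂)
open import Data.Product.Properties using (Σ-≡,≡→≡)
open import Data.Sum.Base using (_⊎_; inj₁; inj₂)
open import Data.Vec.Base as Vec using ()
open import Data.Vec.Properties using (lookup⇒[]=; []=⇒lookup; lookup∘tabulate)
open import Data.Vec.Properties.WithK using ([]=-irrelevant)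
open import Function.Base using (_∘_; id)
open import Function.Bundles using (Inverse; Equivalence; mk↔ₛ′)
open import Function.Definitions using (Injective)
open import Relation.Binary.Definitions using (tri<; tri≈; tri>)
open import Relation.Binary.PropositionalEquality
  using (_≡_; _≢_; refl; sym; trans; cong; cong₂; subst; subst₂; module ≡-Reasoning)
open import Relation.Nullary.Decidable
  using (Dec; yes; no; does; ⌊_⌋; toWitness; fromWitness; _×-dec_; dec-true; dec-false)
open import Relation.Nullary.Negation using (¬_; contradiction)
open import Relation.Unary using (Decidable)
open import Algebra.Properties.Semiring.Sum +-*-semiring
  using (sum-syntax; sum-cong-≗; ∑-distrib-+; ∑-comm; ∑-permute; sum-replicate-zero)

private
  variable
    k n p : ℕ

T-antisym : ∀ {x y} → (T x → T y) → (T y → T x) → x ≡ y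
T-antisym {true}  {true}  f g = refl
T-antisym {true}  {false} f g = ⊥-elim (f _)
T-antisym {false} {true}  f g = ⊥-elim (g _)
T-antisym {false} {false} f g = refl

-- Finite sums and counting

𝟙 : Bool → ℕ
𝟙 true  = 1
𝟙 false = 0

𝟙≤1 : ∀ b → 𝟙 b ≤ 1
𝟙≤1 true  = ≤-refl
𝟙≤1 false = z≤n

𝟙-T : ∀ {b} → T b → 𝟙 b ≡ 1
𝟙-T {true} _ = refl

𝟙-¬T : ∀ {b} → ¬ T b → 𝟙 b ≡ 0
𝟙-¬T {true}  ¬b = ⊥-elim (¬b _)
𝟙-¬T {false} _  = refl

𝟙-∨ : ∀ x y → (T x → ¬ T y) → 𝟙 (x ∨ y) ≡ 𝟙 x + 𝟙 y
𝟙-∨ true  true  disjoint = ⊥-elim (disjoint _ _)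
𝟙-∨ true  false _        = refl
𝟙-∨ false y     _        = refl

∑-mono-≤ : ∀ {f g : Fin n → ℕ} → (∀ i → f i ≤ g i) → ∑[ i < n ] f i ≤ ∑[ i < n ] g i
∑-mono-≤ {n = zero}  f≤g = z≤n
∑-mono-≤ {n = suc n} f≤g = +-mono-≤ (f≤g zero) (∑-mono-≤ (f≤g ∘ suc))

∑-const : ∀ n x → ∑[ i < n ] x ≡ n * x
∑-const zero    x = refl
∑-const (suc n) x = cong (x +_) (∑-const n x)

∑-zero : ∀ {f : Fin n → ℕ} → (∀ i → f i ≡ 0) → ∑[ i < n ] f i ≡ 0
∑-zero {n} f≡0 = trans (sum-cong-≗ {n} f≡0) (sum-replicate-zero n)

∑-split : ∀ a b (f : ℕ → ℕ) →
  ∑[ i < a + b ] f (toℕ i) ≡ ∑[ i < a ] f (toℕ i) + ∑[ i < b ] f (a + toℕ i)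
∑-split zero    b f = refl
∑-split (suc a) b f = trans (cong (f 0 +_) (∑-split a b (f ∘ suc))) (sym (+-assoc (f 0) _ _))

-- Reindex by `reverse`, which sends `i` to `n - 1 - i`. The `suc` appears because `n ∸ i` runs
-- through `1, …, n`, not `0, …, n - 1`.
∑-reverse : ∀ n (f : ℕ → ℕ) → ∑[ i < n ] f (n ∸ toℕ i) ≡ ∑[ i < n ] f (suc (toℕ i))
∑-reverse n f = trans (∑-permute {m = n} {n = n} (λ i → f (n ∸ toℕ i)) reverse)
  (sum-cong-≗ {n} λ i → cong f (lemma i))
  where
  lemma : ∀ i → n ∸ toℕ (opposite i) ≡ suc (toℕ i)
  lemma i = trans (cong (n ∸_) (opposite-prop i)) (ℕ.m∸[m∸n]≡n (toℕ<n i))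

∑-below : ∀ {a} → a ≤ n → ∑[ i < n ] 𝟙 (toℕ i <ᵇ a) ≡ a
∑-below {n} z≤n       = ∑-zero {n} λ _ → refl
∑-below     (s≤s a≤n) = cong suc (∑-below a≤n)

∑-single : ∀ n a → ∑[ i < n ] 𝟙 (a ≡ᵇ toℕ i) ≡ 𝟙 (a <ᵇ n)
∑-single zero    a       = refl
∑-single (suc n) zero    = cong suc (∑-zero {n} λ _ → refl)
∑-single (suc n) (suc a) = ∑-single n a

count : (Fin n → Bool) → ℕ
count {n} P = ∑[ i < n ] 𝟙 (P i)

record Enumeration (P : Fin n → Bool) (c : ℕ) : Set where
  field
    element    : Fin c → Fin n
    satisfies  : ∀ i → T (P (element i))
    injective  : Injective _≡_ _≡_ element
    surjective : ∀ j → T (P j) → ∃[ i ] element i ≡ j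

-- Converts a degree, which is only a number, into actual neighbours from which a star can be built.
enumerate : (P : Fin n → Bool) → Enumeration P (count P)
enumerate {zero}  P = record
  { element = λ () ; satisfies = λ () ; injective = λ { {()} } ; surjective = λ () }
enumerate {suc n} P = extend (P zero) refl (enumerate (P ∘ suc))
  where
  extend : ∀ {c} b → P zero ≡ b → Enumeration (P ∘ suc) c → Enumeration P (𝟙 b + c)
  extend false P₀ E = record
    { element    = suc ∘ element
    ; satisfies  = satisfies
    ; injective  = injective ∘ suc-injective
    ; surjective = λ where
        zero    T₀ → ⊥-elim (subst T P₀ T₀)
        (suc j) Tj → let i , eq = surjective j Tj in i , cong suc eq
    }
    where open Enumeration E
  extend {c} true P₀ E = record
    { element    = element′
    ; satisfies  = λ where zero → subst T (sym P₀) _ ; (suc i) → satisfies i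
    ; injective  = element′-injective
    ; surjective = λ where
        zero    _  → zero , refl
        (suc j) Tj → let i , eq = surjective j Tj in suc i , cong suc eq
    }
    where
    open Enumeration E

    element′ : Fin (suc c) → Fin (suc n)
    element′ zero    = zero
    element′ (suc i) = suc (element i)

    element′-injective : Injective _≡_ _≡_ element′
    element′-injective {zero}  {zero}  _  = refl
    element′-injective {suc _} {suc _} eq = cong suc (injective (suc-injective eq))

-- Each `f i` has a rank in the enumeration of `P`. The rank determines `f i`, so ranking is
-- injective and the pigeonhole principle applies.
injection⇒≤count : (P : Fin n → Bool) (f : Fin k → Fin n) → Injective _≡_ _≡_ f →
  (∀ i → T (P (f i))) → k ≤ count P
injection⇒≤count P f f-injective Pf = injective⇒≤ {f = λ i → proj₁ (rank i)} λ {i} {j} eq →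
  f-injective (trans (sym (proj₂ (rank i))) (trans (cong element eq) (proj₂ (rank j))))
  where
  open Enumeration (enumerate P)
  rank : ∀ i → ∃[ r ] element r ≡ f i
  rank i = surjective (f i) (Pf i)

-- A missed `j` could be put in front of `f`, giving `suc k` distinct elements that satisfy `P`.
injection-saturates : (P : Fin n → Bool) (f : Fin k → Fin n) → Injective _≡_ _≡_ f →
  (∀ i → T (P (f i))) → count P ≤ k → ∀ j → T (P j) → ∃[ i ] f i ≡ j
injection-saturates {n} {k} P f f-injective Pf count≤k j Pj with any? (λ i → f i ≟ j)
... | yes found    = found
... | no  ¬found = contradiction (≤-trans (injection⇒≤count P g g-injective Pg) count≤k) ℕ.1+n≰n
  where
  g : Fin (suc k) → Fin n
  g zero    = j
  g (suc i) = f i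

  g-injective : Injective _≡_ _≡_ g
  g-injective {zero}  {zero}  _  = refl
  g-injective {zero}  {suc y} eq = contradiction (y , sym eq) ¬found
  g-injective {suc x} {zero}  eq = contradiction (x , eq) ¬found
  g-injective {suc x} {suc y} eq = cong suc (f-injective eq)

  Pg : ∀ i → T (P (g i))
  Pg zero    = Pj
  Pg (suc i) = Pf i

unique⇒count≤1 : (P : Fin n → Bool) → (∀ i j → T (P i) → T (P j) → i ≡ j) → count P ≤ 1
unique⇒count≤1 P unique with count P | enumerate P
... | zero        | _ = z≤n
... | suc zero    | _ = ≤-refl
... | suc (suc _) | E with Enumeration.injective E
      (unique _ _ (Enumeration.satisfies E zero) (Enumeration.satisfies E (suc zero)))
... | ()

length-filter-tabulate : ∀ {A : Set} {Q : A → Set} (Q? : Decidable Q) (f : Fin n → A) →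
  length (filter Q? (tabulate f)) ≡ count (does ∘ Q? ∘ f)
length-filter-tabulate {zero}  Q? f = refl
length-filter-tabulate {suc n} Q? f with does (Q? (f zero))
... | true  = cong suc (length-filter-tabulate Q? (f ∘ suc))
... | false = length-filter-tabulate Q? (f ∘ suc)

-- Makes `size` a double sum of indicators, so that the handshake lemma becomes an exchange of
-- summations.
length-filter-cartesianProduct : ∀ {A B : Set} {Q : A × B → Set} (Q? : Decidable Q)
  (f : Fin n → A) (g : Fin k → B) →
  length (filter Q? (cartesianProduct (tabulate f) (tabulate g)))
    ≡ ∑[ i < n ] count (λ j → does (Q? (f i , g j)))
length-filter-cartesianProduct {zero}  Q? f g = refl
length-filter-cartesianProduct {suc n} {k} Q? f g = begin
  length (filter Q? (row ++ rest))                        ≡⟨ cong length (filter-++ Q? row rest) ⟩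
  length (filter Q? row ++ filter Q? rest)                ≡⟨ length-++ (filter Q? row) ⟩
  length (filter Q? row) + length (filter Q? rest)
    ≡⟨ cong₂ _+_ (trans (cong (length ∘ filter Q?) (map-tabulate g (f zero ,_)))
                        (length-filter-tabulate {k} Q? (λ j → f zero , g j)))
                 (length-filter-cartesianProduct Q? (f ∘ suc) g) ⟩
  _ ∎
  where
  open ≡-Reasoning
  row  = List.map (f zero ,_) (tabulate g)
  rest = cartesianProduct (tabulate (f ∘ suc)) (tabulate g)

-- Degrees

degree : Graph (Fin n) → Fin n → ℕ
degree G v = count (adj G v)

adj-comm : ∀ {V : Set} (G : Graph V) u v → adj G u v ≡ adj G v u
adj-comm G u v = T-antisym (Graph.symmetric G) (Graph.symmetric G)

-- One of the two copies of `size G` is transposed and then counts the pairs with `j < i`. For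
-- `i ≠ j` exactly one of the two orders holds, and the diagonal contributes nothing.
handshake : (G : Graph (Fin n)) → ∑[ v < n ] degree G v ≡ size G + size G
handshake {n} G = sym (begin
  size G + size G
    ≡⟨ cong₂ _+_ size-∑ (trans size-∑ (∑-comm a)) ⟩
  ∑[ i < n ] ∑[ j < n ] a i j + ∑[ i < n ] ∑[ j < n ] a j i
    ≡⟨ ∑-distrib-+ {n} _ _ ⟨
  ∑[ i < n ] (∑[ j < n ] a i j + ∑[ j < n ] a j i)
    ≡⟨ (sum-cong-≗ {n} λ i → trans (sym (∑-distrib-+ {n} _ _)) (sum-cong-≗ {n} (orient i))) ⟩
  ∑[ i < n ] degree G i ∎)
  where
  open ≡-Reasoning
  a : Fin n → Fin n → ℕ
  a i j = 𝟙 (does (i <? j) ∧ adj G i j)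

  size-∑ : size G ≡ ∑[ i < n ] ∑[ j < n ] a i j
  size-∑ = length-filter-cartesianProduct {n} {n} (λ (i , j) → (i <? j) ×-dec T? (adj G i j)) id id

  orient : ∀ i j → a i j + a j i ≡ 𝟙 (adj G i j)
  orient i j rewrite adj-comm G j i with <-cmp i j
  ... | tri< i<j _ j≮i rewrite dec-true (i <? j) i<j | dec-false (j <? i) j≮i = +-identityʳ _
  ... | tri> i≮j _ j<i rewrite dec-true (j <? i) j<i | dec-false (i <? j) i≮j = refl
  ... | tri≈ i≮i refl _ rewrite dec-false (i <? i) i≮i = sym (𝟙-¬T (Graph.irreflexive G))

-- Copies as images of embeddings

-- Adjacency is preserved but not reflected, since copies need not be induced.
record Embedding (H : Graph (Fin k)) (G : Graph (Fin n)) : Set where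
  field
    map       : Fin k → Fin n
    injective : Injective _≡_ _≡_ map
    preserves : ∀ {x y} → T (adj H x y) → T (adj G (map x) (map y))

open Embedding using () renaming (map to _⟨_⟩)

infix 4 _⊑_

_⊑_ : ∀ {G : Graph (Fin n)} → Subgraph G → Subgraph G → Set
S ⊑ S′ = Subgraph.vertices S ⊆ Subgraph.vertices S′
       × (∀ u v → T (Subgraph.edge S u v) → T (Subgraph.edge S′ u v))

⊑-antisym : ∀ {G : Graph (Fin n)} {S S′ : Subgraph G} → S ⊑ S′ → S′ ⊑ S → S ≈ S′
⊑-antisym (V⊆ , E⊆) (V⊇ , E⊇) = ⊆-antisym V⊆ V⊇ , λ u v → T-antisym (E⊆ u v) (E⊇ u v)

module _ {H : Graph (Fin k)} {G : Graph (Fin n)} (φ : Embedding H G) where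

  private
    hit? : ∀ u → Dec (∃[ x ] φ ⟨ x ⟩ ≡ u)
    hit? u = any? λ x → φ ⟨ x ⟩ ≟ u

    hitEdge? : ∀ u v → Dec (∃[ x ] ∃[ y ] φ ⟨ x ⟩ ≡ u × φ ⟨ y ⟩ ≡ v × T (adj H x y))
    hitEdge? u v = any? λ x → any? λ y → φ ⟨ x ⟩ ≟ u ×-dec φ ⟨ y ⟩ ≟ v ×-dec T? (adj H x y)

    range : Subset n
    range = Vec.tabulate λ u → ⌊ hit? u ⌋

    ∈-range⁺ : ∀ x → φ ⟨ x ⟩ ∈ range
    ∈-range⁺ x = lookup⇒[]= _ range
      (trans (lookup∘tabulate _ (φ ⟨ x ⟩)) (Equivalence.to T-≡ (fromWitness (x , refl))))

    ∈-range⁻ : ∀ {u} → u ∈ range → ∃[ x ] φ ⟨ x ⟩ ≡ u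
    ∈-range⁻ {u} u∈ = toWitness
      (Equivalence.from T-≡ (trans (sym (lookup∘tabulate _ u)) ([]=⇒lookup u∈)))

  image : Subgraph G
  image = record
    { vertices  = range
    ; edge      = λ u v → ⌊ hitEdge? u v ⌋
    ; symmetric = λ e → let x , y , xu , yv , xy = toWitness e in
                        fromWitness (y , x , yv , xu , Graph.symmetric H xy)
    ; incident  = λ e → let x , _ , xu , _ = toWitness e in subst (_∈ range) xu (∈-range⁺ x)
    ; included  = λ e → let x , y , xu , yv , xy = toWitness e in
                        subst₂ (λ u v → T (adj G u v)) xu yv (Embedding.preserves φ xy)
    }

  image-vertex : ∀ x → φ ⟨ x ⟩ ∈ Subgraph.vertices image
  image-vertex = ∈-range⁺

  image-edge : ∀ {x y} → T (adj H x y) → T (Subgraph.edge image (φ ⟨ x ⟩) (φ ⟨ y ⟩))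
  image-edge e = fromWitness (_ , _ , refl , refl , e)

  -- The search for a preimage inverts the map by injectivity. Membership proofs are irrelevant, so
  -- vertices of the image are equal once they agree in `Fin n`.
  image-isCopy : IsCopy H image
  image-isCopy = mk↔ₛ′ to from to∘from from∘to , agree
    where
    V : Set
    V = ∃[ v ] v ∈ range

    to : V → Fin k
    to (_ , v∈) = proj₁ (∈-range⁻ v∈)

    from : Fin k → V
    from x = φ ⟨ x ⟩ , ∈-range⁺ x

    φ∘to : ∀ u → φ ⟨ to u ⟩ ≡ proj₁ u
    φ∘to (_ , u∈) = proj₂ (∈-range⁻ u∈)

    to∘from : ∀ x → to (from x) ≡ x
    to∘from x = Embedding.injective φ (φ∘to (from x))

    from∘to : ∀ u → from (to u) ≡ u
    from∘to u = Σ-≡,≡→≡ (φ∘to u , []=-irrelevant _ _)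

    agree : ∀ u v → ⌊ hitEdge? (proj₁ u) (proj₁ v) ⌋ ≡ adj H (to u) (to v)
    agree u v = T-antisym
      (λ e → let x , y , xu , yv , xy = toWitness e in
             subst₂ (λ x y → T (adj H x y))
               (Embedding.injective φ (trans xu (sym (φ∘to u))))
               (Embedding.injective φ (trans yv (sym (φ∘to v)))) xy)
      (λ e → fromWitness (to u , to v , φ∘to u , φ∘to v , e))

  ⊑-image : (S : Subgraph G) →
    (∀ {u} → u ∈ Subgraph.vertices S → ∃[ x ] φ ⟨ x ⟩ ≡ u) →
    (∀ {u v} → T (Subgraph.edge S u v) →
      ∃[ x ] ∃[ y ] φ ⟨ x ⟩ ≡ u × φ ⟨ y ⟩ ≡ v × T (adj H x y)) →
    S ⊑ image
  ⊑-image S V⊆ E⊆ = (λ u∈ → let x , eq = V⊆ u∈ in subst (_∈ range) eq (∈-range⁺ x))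
                  , (λ u v e → fromWitness (E⊆ e))

  image-⊑ : (S : Subgraph G) →
    (∀ x → φ ⟨ x ⟩ ∈ Subgraph.vertices S) →
    (∀ {x y} → T (adj H x y) → T (Subgraph.edge S (φ ⟨ x ⟩) (φ ⟨ y ⟩))) →
    image ⊑ S
  image-⊑ S V⊆ E⊆ = (λ u∈ → let x , eq = ∈-range⁻ u∈ in subst (_∈ Subgraph.vertices S) eq (V⊆ x))
                  , (λ u v e → let x , y , xu , yv , xy = toWitness e in
                       subst₂ (λ u v → T (Subgraph.edge S u v)) xu yv (E⊆ xy))

-- The inverse of the isomorphism, followed by the inclusion into `G`, is the embedding. By
-- `incident`, both ends of an edge of `S` lie in `S` and so have preimages.
copy⇒embedding : {H : Graph (Fin k)} {G : Graph (Fin n)} (S : Subgraph G) → IsCopy H S →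
  Σ[ φ ∈ Embedding H G ] S ≈ image φ
copy⇒embedding {H = H} S (f , agree) = φ , ⊑-antisym {S = S} {S′ = image φ}
  (⊑-image φ S (λ u∈ → to (_ , u∈) , cong proj₁ (strictlyInverseʳ (_ , u∈)))
     (λ e → let u = _ , incident e ; v = _ , incident (symmetric e) in
            to u , to v , cong proj₁ (strictlyInverseʳ u) , cong proj₁ (strictlyInverseʳ v)
          , subst T (agree u v) e))
  (image-⊑ φ S (proj₂ ∘ from) edge-from)
  where
  open Inverse f
  open Subgraph S

  edge-from : ∀ {x y} → T (adj H x y) → T (edge (proj₁ (from x)) (proj₁ (from y)))
  edge-from {x} {y} e = subst T (sym (agree (from x) (from y)))
    (subst₂ (λ x y → T (adj H x y)) (sym (strictlyInverseˡ x)) (sym (strictlyInverseˡ y)) e)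

  φ : Embedding _ _
  φ = record
    { map       = proj₁ ∘ from
    ; injective = λ {x} {y} eq → trans (sym (strictlyInverseˡ x))
        (trans (cong to (Σ-≡,≡→≡ (eq , []=-irrelevant _ _))) (strictlyInverseˡ y))
    ; preserves = included ∘ edge-from
    }

free⇒¬embedding : {H : Graph (Fin k)} {G : Graph (Fin n)} → H Free G → ¬ Embedding H G
free⇒¬embedding free φ = free (image φ , image-isCopy φ)

-- Through `σ`, each vertex and edge of the first image is a vertex or edge of the second.
image-reparametrise : {H : Graph (Fin k)} {G : Graph (Fin n)} (φ ψ : Embedding H G)
  (σ : Fin k → Fin k) → (∀ x → ψ ⟨ σ x ⟩ ≡ φ ⟨ x ⟩) →
  (∀ {x y} → T (adj H x y) → T (adj H (σ x) (σ y))) → image φ ⊑ image ψ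
image-reparametrise φ ψ σ ψσ≡φ σ-hom = image-⊑ φ (image ψ)
  (λ x → subst (_∈ Subgraph.vertices (image ψ)) (ψσ≡φ x) (image-vertex ψ (σ x)))
  (λ {x} {y} e → subst₂ (λ u v → T (Subgraph.edge (image ψ) u v)) (ψσ≡φ x) (ψσ≡φ y)
                   (image-edge ψ (σ-hom e)))

-- Stars

module _ {G : Graph (Fin n)} where

  star-embedding⇒degree : (φ : Embedding (star p) G) → p ≤ degree G (φ ⟨ zero ⟩)
  star-embedding⇒degree φ = injection⇒≤count (adj G (φ ⟨ zero ⟩)) (λ i → φ ⟨ suc i ⟩)
    (suc-injective ∘ Embedding.injective φ) (λ i → Embedding.preserves φ {zero} {suc i} _)

  -- The first `p` enumerated neighbours serve as leaves; irreflexivity keeps them apart from the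
  -- centre.
  degree⇒star-embedding : ∀ {v} → p ≤ degree G v →
    Σ[ φ ∈ Embedding (star p) G ] φ ⟨ zero ⟩ ≡ v
  degree⇒star-embedding {p} {v} p≤deg = record
    { map = map ; injective = map-injective ; preserves = λ {x} {y} → map-preserves x y } , refl
    where
    open Enumeration (enumerate (adj G v))

    map : Fin (suc p) → Fin n
    map zero    = v
    map (suc i) = element (inject≤ i p≤deg)

    leaf : ∀ i → T (adj G v (map (suc i)))
    leaf i = satisfies (inject≤ i p≤deg)

    map-injective : Injective _≡_ _≡_ map
    map-injective {zero}  {zero}  _  = refl
    map-injective {zero}  {suc j} eq =
      ⊥-elim (Graph.irreflexive G (subst (T ∘ adj G v) (sym eq) (leaf j)))
    map-injective {suc i} {zero}  eq =
      ⊥-elim (Graph.irreflexive G (subst (T ∘ adj G v) eq (leaf i)))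
    map-injective {suc i} {suc j} eq = cong suc (inject≤-injective _ _ i j (injective eq))

    map-preserves : ∀ x y → T (adj (star p) x y) → T (adj G (map x) (map y))
    map-preserves zero    (suc j) _ = leaf j
    map-preserves (suc i) zero    _ = Graph.symmetric G (leaf i)

  star-free⇒degree< : star p Free G → ∀ v → degree G v < p
  star-free⇒degree< free v = ℕ.≰⇒> λ p≤deg →
    free⇒¬embedding free (proj₁ (degree⇒star-embedding p≤deg))

  degree<⇒star-free : (∀ v → degree G v < p) → star p Free G
  degree<⇒star-free degree<p (S , S-copy) = let φ , _ = copy⇒embedding S S-copy in
    ℕ.<⇒≱ (degree<p _) (star-embedding⇒degree φ)

  -- By the degree bound the `p` leaves of `ψ` are all the neighbours of the common centre, so each
  -- leaf of `φ` is among them.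
  star-images-⊑ : (φ ψ : Embedding (star p) G) → φ ⟨ zero ⟩ ≡ ψ ⟨ zero ⟩ →
    degree G (ψ ⟨ zero ⟩) ≤ p → image φ ⊑ image ψ
  star-images-⊑ {p} φ ψ centre≡ deg≤p = image-reparametrise φ ψ σ ψσ≡φ (λ {x} {y} → σ-hom x y)
    where
    leaf : ∀ i → ∃[ j ] ψ ⟨ suc j ⟩ ≡ φ ⟨ suc i ⟩
    leaf i = injection-saturates (adj G (ψ ⟨ zero ⟩)) (λ j → ψ ⟨ suc j ⟩)
      (suc-injective ∘ Embedding.injective ψ) (λ j → Embedding.preserves ψ {zero} {suc j} _)
      deg≤p (φ ⟨ suc i ⟩)
      (subst (λ c → T (adj G c (φ ⟨ suc i ⟩))) centre≡ (Embedding.preserves φ {zero} {suc i} _))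

    σ : Fin (suc p) → Fin (suc p)
    σ zero    = zero
    σ (suc i) = suc (proj₁ (leaf i))

    ψσ≡φ : ∀ x → ψ ⟨ σ x ⟩ ≡ φ ⟨ x ⟩
    ψσ≡φ zero    = sym centre≡
    ψσ≡φ (suc i) = proj₂ (leaf i)

    σ-hom : ∀ x y → T (adj (star p) x y) → T (adj (star p) (σ x) (σ y))
    σ-hom zero    (suc _) _ = _
    σ-hom (suc _) zero    _ = _

  -- The centre of a star has degree at least `p`, hence is `v`; and all stars centred at `v` have
  -- the same leaves.
  unique-star : ∀ {v} → degree G v ≡ p → (∀ {u} → u ≢ v → degree G u < p) →
    ∃! _≈_ (IsCopy (star p) {G})
  unique-star {p} {v} deg≡p others<p = image φ , image-isCopy φ , λ {S} → unique S
    where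
    φ : Embedding (star p) G
    φ = proj₁ (degree⇒star-embedding (≤-reflexive (sym deg≡p)))

    centre≡v : (ψ : Embedding (star p) G) → ψ ⟨ zero ⟩ ≡ v
    centre≡v ψ with ψ ⟨ zero ⟩ ≟ v
    ... | yes eq  = eq
    ... | no  neq = contradiction (star-embedding⇒degree ψ) (ℕ.<⇒≱ (others<p neq))

    images-⊑ : (ψ χ : Embedding (star p) G) → image ψ ⊑ image χ
    images-⊑ ψ χ = star-images-⊑ ψ χ (trans (centre≡v ψ) (sym (centre≡v χ)))
      (≤-reflexive (trans (cong (degree G) (centre≡v χ)) deg≡p))

    unique : ∀ S → IsCopy (star p) S → image φ ≈ S
    unique S S-copy with copy⇒embedding S S-copy
    ... | ψ , V≡ , E≡ with ⊑-antisym {S = image φ} {S′ = image ψ} (images-⊑ φ ψ) (images-⊑ ψ φ)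
    ... | V≡′ , E≡′ = trans V≡′ (sym V≡) , λ u v → trans (E≡′ u v) (sym (E≡ u v))

-- The extremal graphs

module Circulant (k m t : ℕ) (k<m : k < m) (t≤1+m : t ≤ suc m) where

  order : ℕ
  order = suc (m + m)

  -- The condition `1 ≤ d ≤ k`.
  near : ℕ → Bool
  near zero    = false
  near (suc d) = d <ᵇ k

  near⇒≤ : ∀ d → T (near d) → d ≤ k
  near⇒≤ (suc d) = <ᵇ⇒< d k

  -- For a difference `d ≤ order`: the two arcs of the cycle have lengths `d` and `order ∸ d`, and
  -- one of them lies in `1, …, k`.
  chord : ℕ → Bool
  chord d = near d ∨ near (order ∸ d)

  -- The orientation i ↦ i + m of the extra edges, for i < t only: t = m gives
  -- the extremal star-free graph and t = m + 1 the graph with a single star.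
  match : ℕ → ℕ → Bool
  match i j = (i <ᵇ t) ∧ (m + i ≡ᵇ j)

  match⇒ : ∀ i j → T (match i j) → i < t × m + i ≡ j
  match⇒ i j e = let i<t , eq = Equivalence.to (T-∧ {i <ᵇ t}) e in
    <ᵇ⇒< i t i<t , ≡ᵇ⇒≡ (m + i) j eq

  link : ℕ → ℕ → Bool
  link i j = chord ∣ i - j ∣ ∨ (match i j ∨ match j i)

  chord-reflect : ∀ {d} → d ≤ order → chord (order ∸ d) ≡ chord d
  chord-reflect {d} d≤ =
    trans (cong (λ e → near (order ∸ d) ∨ near e) (ℕ.m∸[m∸n]≡n d≤))
          (∨-comm (near (order ∸ d)) (near d))

  ¬chord-0 : ¬ T (chord 0)
  ¬chord-0 e = ℕ.<⇒≱ (ℕ.<-≤-trans k<m (m≤m+n m m)) (ℕ.<⇒≤ (near⇒≤ order e))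

  -- The arcs have lengths `m` and `m + 1`, both above `k`. Hence no matching edge is already a
  -- chord.
  ¬chord-m : ¬ T (chord m)
  ¬chord-m e with Equivalence.to (T-∨ {near m}) e
  ... | inj₁ e₁ = ℕ.<⇒≱ k<m (near⇒≤ m e₁)
  ... | inj₂ e₂ = ℕ.<⇒≱ k<m (ℕ.<⇒≤ (near⇒≤ (suc m)
    (subst (T ∘ near) (ℕ.m+n∸n≡m (suc m) m) e₂)))

  ¬match-refl : ∀ i → ¬ T (match i i)
  ¬match-refl i e = ℕ.<-irrefl (sym (proj₂ (match⇒ i i e)))
    (ℕ.+-monoˡ-≤ i (≤-trans (s≤s z≤n) k<m))

  ¬match-sym : ∀ i j → T (match i j) → ¬ T (match j i)
  ¬match-sym i j e e′ = ℕ.<-asym (lt i j e) (lt j i e′)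
    where
    lt : ∀ i j → T (match i j) → i < j
    lt i j e = subst (i <_) (proj₂ (match⇒ i j e)) (ℕ.+-monoˡ-≤ i (≤-trans (s≤s z≤n) k<m))

  match⇒¬chord : ∀ i j → T (match i j) → ¬ T (chord ∣ i - j ∣)
  match⇒¬chord i j e = subst (λ d → ¬ T (chord d)) (sym distance) ¬chord-m
    where
    distance : ∣ i - j ∣ ≡ m
    distance = trans (cong (∣ i -_∣) (trans (sym (proj₂ (match⇒ i j e))) (+-comm m i)))
                     (ℕ.∣m-m+n∣≡n i m)

  chord⇒¬match : ∀ i j → T (chord ∣ i - j ∣) → ¬ T (match i j ∨ match j i)
  chord⇒¬match i j c e with Equivalence.to (T-∨ {match i j}) e
  ... | inj₁ ij = match⇒¬chord i j ij c
  ... | inj₂ ji = match⇒¬chord j i ji (subst (T ∘ chord) (ℕ.∣-∣-comm i j) c)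

  link-comm : ∀ i j → link i j ≡ link j i
  link-comm i j = cong₂ _∨_ (cong chord (ℕ.∣-∣-comm i j)) (∨-comm (match i j) (match j i))

  ¬link-refl : ∀ i → ¬ T (link i i)
  ¬link-refl i e with Equivalence.to (T-∨ {chord ∣ i - i ∣}) e
  ... | inj₁ c = ¬chord-0 (subst (T ∘ chord) (ℕ.∣n-n∣≡0 i) c)
  ... | inj₂ c with Equivalence.to (T-∨ {match i i}) c
  ...   | inj₁ ii = ¬match-refl i ii
  ...   | inj₂ ii = ¬match-refl i ii

  graph : Graph (Fin order)
  graph = record
    { adj         = λ i j → link (toℕ i) (toℕ j)
    ; symmetric   = λ {i} {j} → subst T (link-comm (toℕ i) (toℕ j))
    ; irreflexive = λ {i} → ¬link-refl (toℕ i)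
    }

  ∑-chord : ∑[ d < order ] 𝟙 (chord (toℕ d)) ≡ k + k
  ∑-chord = begin
    ∑[ d < order ] 𝟙 (chord (toℕ d))
      ≡⟨ (sum-cong-≗ {order} λ d → 𝟙-∨ (near (toℕ d)) _ (disjoint (toℕ d))) ⟩
    ∑[ d < order ] (𝟙 (near (toℕ d)) + 𝟙 (near (order ∸ toℕ d)))
      ≡⟨ ∑-distrib-+ {order} (𝟙 ∘ near ∘ toℕ) (λ d → 𝟙 (near (order ∸ toℕ d))) ⟩
    ∑[ d < order ] 𝟙 (near (toℕ d)) + ∑[ d < order ] 𝟙 (near (order ∸ toℕ d))
      -- The first sum loses its term `near 0` and has `m + m` terms left; the reversed one runs
      -- over `1, …, order`. Each counts `1, …, k`.
      ≡⟨ cong₂ _+_ (∑-below k≤m+m) (trans (∑-reverse order (𝟙 ∘ near)) (∑-below (ℕ.m≤n⇒m≤1+n k≤m+m))) ⟩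
    k + k ∎
    where
    open ≡-Reasoning
    k≤m+m : k ≤ m + m
    k≤m+m = ≤-trans (ℕ.<⇒≤ k<m) (m≤m+n m m)

    disjoint : ∀ d → T (near d) → ¬ T (near (order ∸ d))
    -- Otherwise `order = d + (order ∸ d)` would be at most `k + k`, which is less than `m + m + 1`.
    disjoint d near-d near-d′ = ℕ.<⇒≱ (s≤s (+-mono-≤ (ℕ.<⇒≤ k<m) (ℕ.<⇒≤ k<m)))
      (≤-trans (ℕ.m≤n+m∸n order d) (+-mono-≤ (near⇒≤ d near-d) (near⇒≤ _ near-d′)))

  -- For j < i the distance i ∸ j is replaced by order ∸ (i ∸ j), so that the
  -- distances run through 0, …, order - 1 once.
  ∑-rotate : ∀ {i} → i ≤ order →
    ∑[ j < order ] 𝟙 (chord ∣ i - toℕ j ∣) ≡ ∑[ d < order ] 𝟙 (chord (toℕ d))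
  ∑-rotate {i} i≤order = begin
    ∑[ j < order ] 𝟙 (chord ∣ i - toℕ j ∣)
      ≡⟨ cong (λ n → ∑[ j < n ] 𝟙 (chord ∣ i - toℕ j ∣)) i+e≡order ⟨
    ∑[ j < i + e ] 𝟙 (chord ∣ i - toℕ j ∣)
      ≡⟨ ∑-split i e (λ j → 𝟙 (chord ∣ i - j ∣)) ⟩
    ∑[ j < i ] 𝟙 (chord ∣ i - toℕ j ∣) + ∑[ d < e ] 𝟙 (chord ∣ i - i + toℕ d ∣)
      ≡⟨ cong₂ _+_ (sum-cong-≗ {i} (cong 𝟙 ∘ wrap))
                   (sum-cong-≗ {e} λ d → cong (𝟙 ∘ chord) (ℕ.∣m-m+n∣≡n i (toℕ d))) ⟩
    ∑[ j < i ] 𝟙 (chord (e + toℕ j)) + ∑[ d < e ] 𝟙 (chord (toℕ d))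
      ≡⟨ +-comm (∑[ j < i ] 𝟙 (chord (e + toℕ j))) _ ⟩
    ∑[ d < e ] 𝟙 (chord (toℕ d)) + ∑[ j < i ] 𝟙 (chord (e + toℕ j))
      ≡⟨ ∑-split e i (𝟙 ∘ chord) ⟨
    ∑[ d < e + i ] 𝟙 (chord (toℕ d))
      ≡⟨ cong (λ n → ∑[ d < n ] 𝟙 (chord (toℕ d))) (trans (+-comm e i) i+e≡order) ⟩
    ∑[ d < order ] 𝟙 (chord (toℕ d)) ∎
    where
    open ≡-Reasoning
    e = order ∸ i
    i+e≡order : i + e ≡ order
    i+e≡order = ℕ.m+[n∸m]≡n i≤order

    wrap : ∀ (j : Fin i) → chord ∣ i - toℕ j ∣ ≡ chord (e + toℕ j)
    wrap j = begin
      chord ∣ i - toℕ j ∣          ≡⟨ cong chord (ℕ.m≤n⇒∣n-m∣≡n∸m j≤i) ⟩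
      chord (i ∸ toℕ j)            ≡⟨ chord-reflect (≤-trans (ℕ.m∸n≤m i (toℕ j)) i≤order) ⟨
      chord (order ∸ (i ∸ toℕ j))  ≡⟨ cong chord complement ⟩
      chord (e + toℕ j)            ∎
      where
      j≤i = ℕ.<⇒≤ (toℕ<n j)
      complement : order ∸ (i ∸ toℕ j) ≡ e + toℕ j
      complement = begin
        order ∸ (i ∸ toℕ j)                        ≡⟨ cong (_∸ (i ∸ toℕ j)) i+e≡order ⟨
        (i + e) ∸ (i ∸ toℕ j)                      ≡⟨ cong (λ x → x + e ∸ (i ∸ toℕ j)) (ℕ.m+[n∸m]≡n j≤i) ⟨
        (toℕ j + (i ∸ toℕ j)) + e ∸ (i ∸ toℕ j)    ≡⟨ cong (_∸ (i ∸ toℕ j)) (rearrange (toℕ j) (i ∸ toℕ j) e) ⟩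
        (e + toℕ j) + (i ∸ toℕ j) ∸ (i ∸ toℕ j)    ≡⟨ ℕ.m+n∸n≡m (e + toℕ j) (i ∸ toℕ j) ⟩
        e + toℕ j ∎
        where
        rearrange : ∀ a b c → (a + b) + c ≡ (c + a) + b
        rearrange = solve-∀

  out into : Fin order → ℕ
  out i = ∑[ j < order ] 𝟙 (match (toℕ i) (toℕ j))
  into i = ∑[ j < order ] 𝟙 (match (toℕ j) (toℕ i))

  -- Chords, outgoing and incoming matching edges exclude one another, so their indicators add up;
  -- the chords contribute `k + k` at every vertex by rotation.
  degree-graph : ∀ i → degree graph i ≡ k + k + (out i + into i)
  degree-graph i = begin
    degree graph i
      ≡⟨ (sum-cong-≗ {order} λ j → trans
           (𝟙-∨ (chord ∣ toℕ i - toℕ j ∣) _ (chord⇒¬match (toℕ i) (toℕ j)))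
           (cong (𝟙 (chord ∣ toℕ i - toℕ j ∣) +_)
             (𝟙-∨ (match (toℕ i) (toℕ j)) _ (¬match-sym (toℕ i) (toℕ j))))) ⟩
    ∑[ j < order ] (𝟙 (chord ∣ toℕ i - toℕ j ∣)
      + (𝟙 (match (toℕ i) (toℕ j)) + 𝟙 (match (toℕ j) (toℕ i))))
      ≡⟨ ∑-distrib-+ {order} (λ j → 𝟙 (chord ∣ toℕ i - toℕ j ∣))
           (λ j → 𝟙 (match (toℕ i) (toℕ j)) + 𝟙 (match (toℕ j) (toℕ i))) ⟩
    ∑[ j < order ] 𝟙 (chord ∣ toℕ i - toℕ j ∣)
      + ∑[ j < order ] (𝟙 (match (toℕ i) (toℕ j)) + 𝟙 (match (toℕ j) (toℕ i)))
      ≡⟨ cong₂ _+_ (trans (∑-rotate (ℕ.<⇒≤ (toℕ<n i))) ∑-chord)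
           (∑-distrib-+ {order} (λ j → 𝟙 (match (toℕ i) (toℕ j))) (λ j → 𝟙 (match (toℕ j) (toℕ i)))) ⟩
    k + k + (out i + into i) ∎
    where open ≡-Reasoning

  out≡ : ∀ i → out i ≡ 𝟙 (toℕ i <ᵇ t)
  out≡ i with toℕ i <ᵇ t in eq
  ... | false = ∑-zero {order} λ _ → refl
  ... | true  = trans (∑-single order (m + toℕ i)) (𝟙-T (<⇒<ᵇ m+i<order))
    where
    m+i<order : m + toℕ i < order
    -- From `i < t ≤ m + 1` follows `i ≤ m`, so the target `m + i` is at most `2m` and is a vertex.
    m+i<order = s≤s (ℕ.+-monoʳ-≤ m (ℕ.≤-pred (≤-trans
      (<ᵇ⇒< (toℕ i) t (Equivalence.from T-≡ eq)) t≤1+m)))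

  out≤1 : ∀ i → out i ≤ 1
  out≤1 i = subst (_≤ 1) (sym (out≡ i)) (𝟙≤1 (toℕ i <ᵇ t))

  out≡1 : ∀ i → toℕ i < t → out i ≡ 1
  out≡1 i i<t = trans (out≡ i) (𝟙-T (<⇒<ᵇ i<t))

  out≡0 : ∀ i → t ≤ toℕ i → out i ≡ 0
  out≡0 i t≤i = trans (out≡ i) (𝟙-¬T λ i<t → ℕ.<⇒≱ (<ᵇ⇒< (toℕ i) t i<t) t≤i)

  into≤1 : ∀ i → into i ≤ 1
  into≤1 i = unique⇒count≤1 {n = order} (λ j → match (toℕ j) (toℕ i)) λ j j′ e e′ →
    toℕ-injective (ℕ.+-cancelˡ-≡ m (toℕ j) (toℕ j′)
      (trans (proj₂ (match⇒ (toℕ j) (toℕ i) e)) (sym (proj₂ (match⇒ (toℕ j′) (toℕ i) e′)))))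

  into≡0 : ∀ i → toℕ i < m → into i ≡ 0
  into≡0 i i<m = ∑-zero {order} λ j → 𝟙-¬T λ e →
    ℕ.<⇒≱ i<m (subst (m ≤_) (proj₂ (match⇒ (toℕ j) (toℕ i) e)) (m≤m+n m (toℕ j)))

  into≡1 : 0 < t → ∀ i → toℕ i ≡ m → into i ≡ 1
  into≡1 0<t i i≡m = ℕ.≤-antisym (into≤1 i) (≤-trans
    -- The edge into `m` comes from the vertex `0`, the first term of the sum.
    (≤-reflexive (sym (𝟙-T {match 0 (toℕ i)} (Equivalence.from (T-∧ {0 <ᵇ t})
      (<⇒<ᵇ 0<t , ≡⇒≡ᵇ (m + 0) (toℕ i) (trans (+-identityʳ m) (sym i≡m)))))))
    (m≤m+n (𝟙 (match 0 (toℕ i))) _))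

  -- No matching edge enters a vertex below `m`, and none leaves a vertex from `t` on, so at most
  -- one is added to the `k + k` chords.
  degree≤ : ∀ i → toℕ i < m ⊎ t ≤ toℕ i → degree graph i < 2 + (k + k)
  degree≤ i side = s≤s (≤-trans (≤-reflexive (degree-graph i))
    (≤-trans (ℕ.+-monoʳ-≤ (k + k) (out+into≤1 side)) (≤-reflexive (+-comm (k + k) 1))))
    where
    out+into≤1 : toℕ i < m ⊎ t ≤ toℕ i → out i + into i ≤ 1
    out+into≤1 (inj₁ i<m) = +-mono-≤ (out≤1 i) (≤-reflexive (into≡0 i i<m))
    out+into≤1 (inj₂ t≤i) = +-mono-≤ (≤-reflexive (out≡0 i t≤i)) (into≤1 i)

  -- The vertex `m` is matched twice: from `0`, and to `2m` because `m < t`.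
  degree-middle : ∀ i → toℕ i ≡ m → m < t → degree graph i ≡ 2 + (k + k)
  degree-middle i i≡m m<t = trans (degree-graph i) (trans
    (cong (k + k +_) (cong₂ _+_ (out≡1 i (subst (_< t) (sym i≡m) m<t))
                           (into≡1 (≤-trans (s≤s z≤n) m<t) i i≡m)))
    (+-comm (k + k) 2))

  -- Exchanging the summations shows that incoming and outgoing matching edges are equally many,
  -- namely `t`.
  size-graph : size graph + size graph ≡ order * (k + k) + (t + t)
  size-graph = begin
    size graph + size graph                               ≡⟨ handshake graph ⟨
    ∑[ i < order ] degree graph i                         ≡⟨ sum-cong-≗ {order} degree-graph ⟩
    ∑[ i < order ] (k + k + (out i + into i))
      ≡⟨ ∑-distrib-+ {order} (λ _ → k + k) (λ i → out i + into i) ⟩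
    ∑[ i < order ] (k + k) + ∑[ i < order ] (out i + into i)
      ≡⟨ cong₂ _+_ (∑-const order (k + k)) (∑-distrib-+ {order} out into) ⟩
    order * (k + k) + (∑[ i < order ] out i + ∑[ i < order ] into i)
      ≡⟨ cong (λ x → order * (k + k) + (∑[ i < order ] out i + x))
           (∑-comm {order} {order} λ i j → 𝟙 (match (toℕ j) (toℕ i))) ⟩
    order * (k + k) + (∑[ i < order ] out i + ∑[ i < order ] out i)
      ≡⟨ cong (λ x → order * (k + k) + (x + x)) ∑-out ⟩
    order * (k + k) + (t + t) ∎
    where
    open ≡-Reasoning
    ∑-out : ∑[ i < order ] out i ≡ t
    ∑-out = trans (sum-cong-≗ {order} out≡) (∑-below (≤-trans t≤1+m (s≤s (m≤m+n m m))))

-- The Turán number and the graph with a single star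

-- If `b < a`, then `a + a` is at least `b + b + 2`. This is where an odd degree sum is rounded
-- down.
double-cancel-≤ : ∀ {a b} → a + a ≤ suc (b + b) → a ≤ b
double-cancel-≤ {a} {b} a+a≤ = ℕ.≮⇒≥ λ b<a → ℕ.<⇒≱
  (subst (_≤ a + a) (cong suc (+-suc b b)) (+-mono-≤ b<a b<a)) a+a≤

unique-star-graph : ∀ k m → k < m → let p = 2 + (k + k) ; n = suc (m + m) in
  ∃[ ex ] IsTuránNumber n (star p) ex ×
    (Σ[ G ∈ Graph (Fin n) ] (size G ≡ ex + 1 × ∃! _≈_ (IsCopy (star p) {G})))
unique-star-graph k m k<m =
    size H , ((H , H-free , refl) , H-maximal)
  , G , size-G , unique-star (G.degree-middle middle middle≡m ≤-refl) G-others
  where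
  module H = Circulant k m m k<m (ℕ.n≤1+n m)
  module G = Circulant k m (suc m) k<m ≤-refl
  open H using (order)
  H = H.graph
  G = G.graph

  middle : Fin order
  middle = fromℕ< {m} (s≤s (m≤m+n m m))

  middle≡m : toℕ middle ≡ m
  middle≡m = toℕ-fromℕ< _

  H-free : star (2 + (k + k)) Free H
  -- With `t = m` the two cases of `degree≤` cover every vertex.
  H-free = degree<⇒star-free λ i → H.degree≤ i (ℕ.<-≤-connex (toℕ i) m)

  -- Degrees of at most `p - 1 = suc (k + k)` sum to at most `order * suc (k + k)`, which is exactly
  -- one more than twice `size H`.
  H-maximal : ∀ K → star (2 + (k + k)) Free K → size K ≤ size H
  H-maximal K free = double-cancel-≤ (begin
    size K + size K                 ≡⟨ handshake K ⟨
    ∑[ i < order ] degree K i       ≤⟨ ∑-mono-≤ (λ i → ℕ.≤-pred (star-free⇒degree< free i)) ⟩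
    ∑[ i < order ] suc (k + k)      ≡⟨ ∑-const order (suc (k + k)) ⟩
    order * suc (k + k)             ≡⟨ ℕ.*-suc order (k + k) ⟩
    suc (m + m + order * (k + k))   ≡⟨ cong suc (+-comm (m + m) _) ⟩
    suc (order * (k + k) + (m + m)) ≡⟨ cong suc H.size-graph ⟨
    suc (size H + size H)           ∎)
    where open ℕ.≤-Reasoning

  size-G : size G ≡ size H + 1
  size-G = ℕ.≤-antisym (double-cancel-≤ (ℕ.m≤n⇒m≤1+n (≤-reflexive doubled)))
                       (double-cancel-≤ (ℕ.m≤n⇒m≤1+n (≤-reflexive (sym doubled))))
    where
    open ≡-Reasoning
    shift : ∀ a b → a + (suc b + suc b) ≡ a + (b + b) + 2
    shift = solve-∀
    unshift : ∀ a → a + a + 2 ≡ (a + 1) + (a + 1)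
    unshift = solve-∀
    -- Passing from `t = m` to `t = m + 1` raises the degree sum by two.
    doubled : size G + size G ≡ (size H + 1) + (size H + 1)
    doubled = begin
      size G + size G                          ≡⟨ G.size-graph ⟩
      order * (k + k) + (suc m + suc m)        ≡⟨ shift (order * (k + k)) m ⟩
      order * (k + k) + (m + m) + 2            ≡⟨ cong (_+ 2) H.size-graph ⟨
      size H + size H + 2                      ≡⟨ unshift (size H) ⟩
      (size H + 1) + (size H + 1)              ∎

  G-others : ∀ {u} → u ≢ middle → degree G u < 2 + (k + k)
  G-others {u} u≢middle with ℕ.<-cmp (toℕ u) m
  ... | tri< u<m _ _ = G.degree≤ u (inj₁ u<m)
  ... | tri≈ _ u≡m _ = contradiction (toℕ-injective (trans u≡m (sym middle≡m))) u≢middle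
  ... | tri> _ _ m<u = G.degree≤ u (inj₂ m<u)

-- Parity and the choice of k and m

odd : ∀ {n} → 2 ∤ n → ∃[ m ] n ≡ suc (m + m)
odd {n} 2∤n with n % 2 in n%2≡ | m≡m%n+[m/n]*n n 2 | m%n<n n 2
... | 0           | _  | _ = contradiction (m%n≡0⇒n∣m n 2 n%2≡) 2∤n
... | 1           | eq | _ = n / 2 , trans eq
  (cong suc (trans (*-comm (n / 2) 2) (cong (n / 2 +_) (+-identityʳ _))))
... | suc (suc _) | _  | s≤s (s≤s ())

theorem1 : ∀ (p n : ℕ) → 2 ∣ p → 2 ∤ n → n ≥ p + 1 → p + 1 ≥ 5 →
    ∃[ ex ] IsTuránNumber n (star p) ex ×
    (Σ[ G ∈ Graph (Fin n) ] (size G ≡ ex + 1 × ∃! _≈_ (IsCopy (star p) {G})))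
-- Here `p = 0`, against `p + 1 ≥ 5`.
theorem1 _ n (divides zero    refl) 2∤n n≥p+1 (s≤s ())
theorem1 _ n (divides (suc k) refl) 2∤n n≥p+1 _ with odd 2∤n
... | m , refl rewrite trans (*-comm k 2) (cong (k +_) (+-identityʳ k)) =
  -- From `p = suc k + suc k` and `p ≤ p + 1 ≤ n = suc (m + m)`, halving gives `suc k ≤ m`.
  unique-star-graph k m (double-cancel-≤ (≤-trans
    (≤-reflexive (cong suc (+-suc k k))) (≤-trans (m≤m+n (2 + (k + k)) 1) n≥p+1)))
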